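{- For $g \in \{2,3,5,10\}$ there is a constant $C_g>0$ such that for all $N \geqslant 1$, $$P_g(N) \leqslant C_g\, \vartheta_g^N,$$ where $\vartheta_2 = 5^{1/3}$, $\vartheta_3 = 2$, $\vartheta_5 = 2$, $\vartheta_{10} = 6$.
   Context: For an integer $g\geqslant 2$ and a finite tuple of $g$-ary digits $(d_0,\ldots,d_{N-1}) \in \{0,\ldots,g-1\}^N$ with $d_{N-1} \neq 0$ (equivalently, an infinite digit sequence $\mathcal{D}=\{d_i\}_{i\ge 0}$ whose last non-zero element is $d_{N-1}$; such $\mathcal{D}$ is said to have length $N$), define $u_{\mathcal{D},g}(n) = \sum_{i=0}^{n-1} d_i g^i$ and let $\varpi_{\mathcal{D},g}(N)$ be the number of $n$ with $1 \leqslant n \leqslant N$ for which $u_{\mathcal{D},g}(n)$ is prime. Let $\eta = 1$ if $g=2$ and $\eta = 0$ if $g \geqslant 3$. Then $P_g(N)$ denotes the number of sequences $\mathcal{D}$ of length $N$ such that $\varpi_{\mathcal{D},g}(N) = N - \eta$. -}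

module Defs where

open import Data.Nat using (ℕ; zero; suc; _+_; _*_; _∸_; _≡ᵇ_)
open import Data.Bool using (Bool; true; false; not; _∧_)
open import Data.List using (List; []; _∷_; [_]; map; concatMap; upTo; take; length; filterᵇ)
open import Data.Nat.Primality using (prime?)
open import Relation.Nullary.Decidable using (isYes)

allDigits : ℕ → ℕ → List (List ℕ)
allDigits g zero    = [ [] ]
allDigits g (suc N) = concatMap (λ d → map (d ∷_) (allDigits g N)) (upTo g)

value : ℕ → List ℕ → ℕ
value g []       = 0
value g (d ∷ ds) = d + g * value g ds

u : ℕ → List ℕ → ℕ → ℕ
u g ds n = value g (take n ds)

varpi : ℕ → List ℕ → ℕ → ℕ
varpi g ds N = length (filterᵇ (λ n → isYes (prime? (u g ds n))) (map suc (upTo N)))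

lastNonZero : List ℕ → Bool
lastNonZero []           = false
lastNonZero (d ∷ [])     = not (d ≡ᵇ 0)
lastNonZero (_ ∷ e ∷ ds) = lastNonZero (e ∷ ds)

eta : ℕ → ℕ
eta g with g ≡ᵇ 2
... | true  = 1
... | false = 0

P : ℕ → ℕ → ℕ
P g N = length (filterᵇ (λ ds → lastNonZero ds ∧ (varpi g ds N ≡ᵇ (N ∸ eta g))) (allDigits g N))

{-# OPTIONS --safe #-}
module Submission where

-- If a prime a + b d exceeds every sieving prime p, then p does not divide it, which forbids the digits d in one class
-- modulo p. The forbidden class evolves as a finite automaton, so counting the paths of this automaton over blocks of
-- k digits bounds the growth rate: k = 3 and p = 3 for g = 2, and k = 4 and p ∈ {3, 7, 11} for g = 10, while single
-- digits suffice for g = 3 (p = 2) and g = 5 (p ∈ {2, 3}).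

open import Defs
open import Data.Nat using (ℕ; _*_; _^_; _≤_; _<_)
open import Data.Product using (Σ; _×_)
open import Data.Bool using (Bool; true; false; T; _∧_; if_then_else_)
open import Data.Bool.Properties using (T-∧)
open import Data.List using (List; []; _∷_; map; concatMap; filterᵇ; length; upTo; applyUpTo; _++_)
open import Data.List.Properties using (length-map; length-applyUpTo)
open import Data.List.Relation.Unary.All as All using (All; []; _∷_; all?)
open import Data.List.Relation.Unary.All.Properties using (concat⁺; map⁺; map⁻; applyUpTo⁺₂; applyUpTo⁻)
open import Data.Nat using (zero; suc; _+_; _∸_; _≡ᵇ_; _%_; NonZero; z≤n; s≤s; z<s; s<s; _≤?_; _<?_)
open import Data.Nat.Divisibility using (_∣_; _∤_; _∣?_; ∣n⇒∣m*n; ∣n∣m%n⇒∣m; %-presˡ-∣)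
open import Data.Nat.DivMod using (%-distribˡ-+; %-distribˡ-*; m%n%n≡m%n; m%n<n)
open import Data.Nat.ListAction using (sum)
open import Data.Nat.Primality using (Prime; prime?; prime⇒irreducible)
open import Data.Nat.Properties
open import Data.Nat.Tactic.RingSolver using (solve-∀)
open import Data.Product using (_,_; proj₂)
open import Data.Sum as Sum using (_⊎_; inj₁; inj₂)
open import Function using (_∘_; id)
open import Function.Bundles using (Equivalence)
open import Relation.Binary.PropositionalEquality using (_≡_; refl; sym; trans; cong; cong₂; subst; subst₂; module ≡-Reasoning)
open import Relation.Nullary using (¬_; Dec; yes; no; does; contradiction)
open import Relation.Nullary.Decidable using (¬?; isYes; from-yes; from-no; _×-dec_)

private
  variable
    A B : Set

-- Finite sums and counting of digit words.

sumUpTo : ℕ → (ℕ → ℕ) → ℕ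
sumUpTo n f = sum (applyUpTo f n)

sumUpTo-mono : ∀ n {f h : ℕ → ℕ} → (∀ {d} → d < n → f d ≤ h d) → sumUpTo n f ≤ sumUpTo n h
sumUpTo-mono zero    f≤h = z≤n
sumUpTo-mono (suc n) f≤h = +-mono-≤ (f≤h z<s) (sumUpTo-mono n (f≤h ∘ s<s))

sumUpTo-bound : ∀ n {f : ℕ → ℕ} {c} → (∀ {d} → d < n → f d ≤ c) → sumUpTo n f ≤ n * c
sumUpTo-bound zero    f≤c = z≤n
sumUpTo-bound (suc n) f≤c = +-mono-≤ (f≤c z<s) (sumUpTo-bound n (f≤c ∘ s<s))

sumUpTo-*ʳ : ∀ n (f : ℕ → ℕ) c → sumUpTo n (λ d → f d * c) ≡ sumUpTo n f * c
sumUpTo-*ʳ zero    f c = refl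
sumUpTo-*ʳ (suc n) f c =
  trans (cong (f 0 * c +_) (sumUpTo-*ʳ n (f ∘ suc) c))
        (sym (*-distribʳ-+ c (f 0) (sumUpTo n (f ∘ suc))))

-- Separates the digit 0 from the others. The rough factor `n` for the remaining `n ∸ 1` terms only
-- enlarges the final constant.
sumUpTo-head : ∀ n {f : ℕ → ℕ} {x y} → f 0 ≤ x → (∀ d → f (suc d) ≤ y) → sumUpTo n f ≤ x + n * y
sumUpTo-head zero            f0≤x f≤y = z≤n
sumUpTo-head (suc n) {x = x} f0≤x f≤y =
  +-mono-≤ f0≤x (≤-trans (sumUpTo-bound n (λ {d} _ → f≤y d)) (m≤n+m _ _))

count : (A → Bool) → List A → ℕ
count p xs = length (filterᵇ p xs)

count-mono : {p q : A → Bool} {xs : List A} → All (λ x → T (p x) → T (q x)) xs → count p xs ≤ count q xs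
count-mono []                                     = z≤n
count-mono {p = p} {q} {x ∷ _} (px⇒qx ∷ ps⇒qs) with p x | q x
... | true  | true  = s≤s (count-mono ps⇒qs)
... | true  | false = contradiction (px⇒qx _) id
... | false | true  = m≤n⇒m≤1+n (count-mono ps⇒qs)
... | false | false = count-mono ps⇒qs

count-none : (p : A → Bool) → (∀ x → ¬ T (p x)) → ∀ xs → count p xs ≡ 0
count-none p ¬p []       = refl
count-none p ¬p (x ∷ xs) with p x | ¬p x
... | true  | ¬px = contradiction _ ¬px
... | false | _   = count-none p ¬p xs

count-≤ : (p : A → Bool) (xs : List A) → count p xs ≤ length xs
count-≤ p []       = z≤n
count-≤ p (x ∷ xs) with p x
... | true  = s≤s (count-≤ p xs)
... | false = m≤n⇒m≤1+n (count-≤ p xs)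

count-full : (p : A → Bool) (xs : List A) → count p xs ≡ length xs → All (T ∘ p) xs
count-full p []       eq = []
count-full p (x ∷ xs) eq with p x in px
... | true  = subst T (sym px) _ ∷ count-full p xs (suc-injective eq)
... | false = contradiction eq (<⇒≢ (s≤s (count-≤ p xs)))

count-++ : (p : A → Bool) (xs ys : List A) → count p (xs ++ ys) ≡ count p xs + count p ys
count-++ p []       ys = refl
count-++ p (x ∷ xs) ys with p x
... | true  = cong suc (count-++ p xs ys)
... | false = count-++ p xs ys

count-map : (p : B → Bool) (f : A → B) (xs : List A) → count p (map f xs) ≡ count (p ∘ f) xs
count-map p f []       = refl
count-map p f (x ∷ xs) with p (f x)
... | true  = cong suc (count-map p f xs)
... | false = count-map p f xs

count-concatMap : (p : B → Bool) (f : A → List B) (h : ℕ → A) (n : ℕ) →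
                  count p (concatMap f (applyUpTo h n)) ≡ sumUpTo n (λ d → count p (f (h d)))
count-concatMap p f h zero    = refl
count-concatMap p f h (suc n) =
  trans (count-++ p (f (h 0)) _) (cong (count p (f (h 0)) +_) (count-concatMap p f (h ∘ suc) n))

count-allDigits : ∀ g N (p : List ℕ → Bool) →
                  count p (allDigits g (suc N)) ≡ sumUpTo g (λ d → count (p ∘ (d ∷_)) (allDigits g N))
count-allDigits g N p = trans (count-concatMap p _ id g) (sumUpTo-cong g λ d → count-map p (d ∷_) (allDigits g N))
  where
  sumUpTo-cong : ∀ n {f h : ℕ → ℕ} → (∀ d → f d ≡ h d) → sumUpTo n f ≡ sumUpTo n h
  sumUpTo-cong zero    f≡h = refl
  sumUpTo-cong (suc n) f≡h = cong₂ _+_ (f≡h 0) (sumUpTo-cong n (f≡h ∘ suc))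

allDigits-length : ∀ g N → All (λ ds → length ds ≡ N) (allDigits g N)
allDigits-length g zero    = refl ∷ []
allDigits-length g (suc N) =
  concat⁺ (map⁺ (applyUpTo⁺₂ id g λ d → map⁺ (All.map (cong suc) (allDigits-length g N))))

-- Prime values of digit prefixes.

isPrime : ℕ → Bool
isPrime n = isYes (prime? n)

isPrime-sound : ∀ {n} → T (isPrime n) → Prime n
isPrime-sound {n} t with prime? n
... | yes n-prime = n-prime

isPrime-complete : ∀ {n} → Prime n → T (isPrime n)
isPrime-complete {n} n-prime with prime? n
... | yes _   = _
... | no ¬n-p = contradiction n-prime ¬n-p

-- The state (a , b) stands for the value a of the digits read so far and the weight b of the next digit.
allPrime : ℕ → ℕ → ℕ → List ℕ → Bool
allPrime g a b []       = true
allPrime g a b (d ∷ ds) = isPrime (a + b * d) ∧ allPrime g (a + b * d) (b * g) ds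

allPrime-complete : ∀ g a b ds → (∀ k → k < length ds → Prime (a + b * u g ds (suc k))) → T (allPrime g a b ds)
allPrime-complete g a b []       primes = _
allPrime-complete g a b (d ∷ ds) primes = Equivalence.from T-∧
  ( isPrime-complete (subst Prime (e₀ a b d g) (primes 0 z<s))
  , allPrime-complete g (a + b * d) (b * g) ds λ k k< →
      subst Prime (e₁ a b d g (u g ds (suc k))) (primes (suc k) (s<s k<)))
  where
  e₀ : ∀ a b d g → a + b * (d + g * 0) ≡ a + b * d
  e₀ = solve-∀
  e₁ : ∀ a b d g v → a + b * (d + g * v) ≡ a + b * d + b * g * v
  e₁ = solve-∀

extensions : ℕ → ℕ → ℕ → ℕ → ℕ
extensions g a b m = count (allPrime g a b) (allDigits g m)

extensions-suc : ∀ g a b m → extensions g a b (suc m) ≤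
  sumUpTo g (λ d → if isPrime (a + b * d) then extensions g (a + b * d) (b * g) m else 0)
extensions-suc g a b m = ≤-trans (≤-reflexive (count-allDigits g m (allPrime g a b))) (sumUpTo-mono g λ {d} _ → pointwise d)
  where
  pointwise : ∀ d → count (λ ds → isPrime (a + b * d) ∧ allPrime g (a + b * d) (b * g) ds) (allDigits g m) ≤
              (if isPrime (a + b * d) then extensions g (a + b * d) (b * g) m else 0)
  pointwise d with isPrime (a + b * d)
  ... | true  = ≤-refl
  ... | false = ≤-reflexive (count-none _ (λ _ ()) (allDigits g m))

prime-divisor-≡ : ∀ {p n} → 1 < p → Prime n → p ∣ n → p ≡ n
prime-divisor-≡ 1<p n-prime p∣n with prime⇒irreducible n-prime p∣n
... | inj₁ p≡1 = contradiction (sym p≡1) (<⇒≢ 1<p)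
... | inj₂ p≡n = p≡n

-- For `e` equal to 1, the failure at `x` uses up the only failure that the count permits.
all-but-first : ∀ (q : A → Bool) x xs {e} → e ≡ 0 ⊎ (e ≡ 1 × ¬ T (q x)) →
                count q (x ∷ xs) ≡ suc (length xs) ∸ e → All (T ∘ q) xs
all-but-first q x xs e-cases eq with q x | e-cases
... | true  | inj₁ refl       = count-full q xs (suc-injective eq)
... | true  | inj₂ (_ , ¬qx)  = contradiction _ ¬qx
... | false | inj₁ refl       = contradiction eq (<⇒≢ (s≤s (count-≤ q xs)))
... | false | inj₂ (refl , _) = count-full q xs eq

-- Treats all bases at once: in base 2 the exempted value is the one at `n = 1`, a single digit 0 or
-- 1, hence never prime.
FirstDigitCondition : ℕ → Set
FirstDigitCondition g = eta g ≡ 0 ⊎ (eta g ≡ 1 × (∀ d → d < g → ¬ Prime d))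

varpi-primes : ∀ {g d} → d < g → FirstDigitCondition g → ∀ ds n →
               varpi g (d ∷ ds) (suc n) ≡ suc n ∸ eta g → ∀ {k} → k < n → Prime (u g (d ∷ ds) (suc (suc k)))
varpi-primes {g} {d} d<g first ds n eq k<n =
  isPrime-sound (applyUpTo⁻ suc n (map⁻ (all-but-first q 1 rest e-cases
    (trans eq (cong (λ l → suc l ∸ eta g) (sym rest-length))))) k<n)
  where
  q : ℕ → Bool
  q i = isPrime (u g (d ∷ ds) i)
  rest : List ℕ
  rest = map suc (applyUpTo suc n)
  rest-length : length rest ≡ n
  rest-length = trans (length-map suc (applyUpTo suc n)) (length-applyUpTo suc n)
  e-cases : eta g ≡ 0 ⊎ (eta g ≡ 1 × ¬ T (q 1))
  e-cases = Sum.map₂ (λ (e≡1 , small) → e≡1 , λ q1 →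
    small d d<g (subst Prime (trans (cong (d +_) (*-zeroʳ g)) (+-identityʳ d)) (isPrime-sound q1))) first

-- Congruences and the sieve automaton.

module Congruence (M : ℕ) .{{_ : NonZero M}} where

  infix 4 _≈_
  _≈_ : ℕ → ℕ → Set
  x ≈ y = x % M ≡ y % M

  +-congʳ-≈ : ∀ {x y} z → x ≈ y → x + z ≈ y + z
  +-congʳ-≈ {x} {y} z x≈y = trans (%-distribˡ-+ x z M)
    (trans (cong (λ r → (r + z % M) % M) x≈y) (sym (%-distribˡ-+ y z M)))

  *-congˡ-≈ : ∀ {x y} z → x ≈ y → z * x ≈ z * y
  *-congˡ-≈ {x} {y} z x≈y = trans (%-distribˡ-* z x M)
    (trans (cong (λ r → (z % M * r) % M) x≈y) (sym (%-distribˡ-* z y M)))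

  ∣-resp-≈ : ∀ {p x y} → p ∣ M → x ≈ y → p ∣ y → p ∣ x
  ∣-resp-≈ {p} p∣M x≈y p∣y = ∣n∣m%n⇒∣m p∣M (subst (p ∣_) (sym x≈y) (%-presˡ-∣ p∣y p∣M))

-- A state (a , b) is abstracted to the residue t with a ≡ b t modulo M, so that a + b d ≡ b (t + d), and the next
-- residue is (t + d) / g, with h the inverse of g modulo M.
module Sieve (g M h : ℕ) .{{_ : NonZero g}} .{{_ : NonZero M}} (ps : List ℕ) where

  open Congruence M

  sieved? : ∀ t d → Dec (All (λ p → p ∤ t + d) ps)
  sieved? t d = all? (λ p → ¬? (p ∣? t + d)) ps

  step : ℕ → ℕ → ℕ
  step t d = (h * (t + d)) % M

  paths : ℕ → ℕ → ℕ
  paths zero    t = 1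
  paths (suc k) t = sumUpTo g (λ d → if does (sieved? t d) then paths k (step t d) else 0)

  -- Cut a path after `k` digits: whatever residue it has reached, at most `c` continuations remain,
  -- since the bound is uniform in the residue.
  paths-+ : ∀ k {m c} → (∀ {t} → t < M → paths m t ≤ c) → ∀ {t} → t < M → paths (k + m) t ≤ paths k t * c
  paths-+ zero    {c = c} bound t<M = ≤-trans (bound t<M) (≤-reflexive (sym (*-identityˡ c)))
  paths-+ (suc k) {m} {c} bound {t} t<M = ≤-trans (sumUpTo-mono g λ {d} _ → pointwise d)
    (≤-reflexive (sumUpTo-*ʳ g (λ d → if does (sieved? t d) then paths k (step t d) else 0) c))
    where
    pointwise : ∀ d → (if does (sieved? t d) then paths (k + m) (step t d) else 0) ≤
                      (if does (sieved? t d) then paths k (step t d) else 0) * c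
    pointwise d with does (sieved? t d)
    ... | true  = paths-+ k bound (m%n<n _ M)
    ... | false = z≤n

  -- `U` majorises the path counts: directly for lengths up to `k`, then by blocks of `suc k`
  -- digits, each costing a factor `L`. Two digits are read before sieving, so weights are at least
  -- `g * g`; this threshold admits 3 in base 2 and 11 in base 10.
  module Bound
    (gh≈1 : g * h ≈ 1)
    (ps-ok : All (λ p → 1 < p × p < g * g × p ∣ M) ps)
    (U : ℕ → ℕ) (k L : ℕ)
    (U-suc : ∀ m → L * U m ≤ U (suc k + m))
    (paths-U : All (λ r → All (λ t → paths r t ≤ U r) (upTo M)) (upTo (suc k)))
    (paths-L : All (λ t → paths (suc k) t ≤ L) (upTo M))
    where

    paths-≤ : ∀ m {t} → t < M → paths m t ≤ U m
    paths-≤ m = go (suc m) m (n<1+n m)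
      where
      -- The fuel `n` makes the recursion structural, as each call removes a whole block from `m`.
      go : ∀ n m → m < n → ∀ {t} → t < M → paths m t ≤ U m
      go (suc n) m (s≤s m≤n) t<M with m <? suc k
      ... | yes m<k = applyUpTo⁻ id M (applyUpTo⁻ id (suc k) paths-U m<k) t<M
      ... | no  m≮k with m ∸ suc k | m+[n∸m]≡n (≮⇒≥ m≮k)
      ...   | m′ | refl = ≤-trans
              (paths-+ (suc k) (go n m′ (≤-trans (s≤s (m≤n+m m′ k)) m≤n)) t<M)
              (≤-trans (*-monoˡ-≤ (U m′) (applyUpTo⁻ id M paths-L t<M)) (U-suc m′))

    -- Inserting the factor `g * h`, which is 1 modulo `M`, moves one `g` into the weight and leaves
    -- `h * (t + d)` as the new residue.
    step-≈ : ∀ {a t} b d → a ≈ b * t → a + b * d ≈ b * g * step t d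
    step-≈ {a} {t} b d a≈bt = begin
      (a + b * d) % M                 ≡⟨ +-congʳ-≈ (b * d) a≈bt ⟩
      (b * t + b * d) % M             ≡⟨ cong (_% M) (e₁ b t d) ⟩
      (b * (t + d) * 1) % M           ≡⟨ *-congˡ-≈ (b * (t + d)) (sym gh≈1) ⟩
      (b * (t + d) * (g * h)) % M     ≡⟨ cong (_% M) (e₂ b (t + d) g h) ⟩
      (b * g * (h * (t + d))) % M     ≡⟨ *-congˡ-≈ (b * g) (sym (m%n%n≡m%n (h * (t + d)) M)) ⟩
      (b * g * step t d) % M          ∎
      where
      open ≡-Reasoning
      e₁ : ∀ b t d → b * t + b * d ≡ b * (t + d) * 1
      e₁ = solve-∀
      e₂ : ∀ b s g h → b * s * (g * h) ≡ b * g * (h * s)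
      e₂ = solve-∀

    -- A sieving prime dividing `t + d` divides the value, because it divides `M`, and so equals it;
    -- but it lies below `g * g`.
    prime-sieved : ∀ {a t} b d → a ≈ b * t → g * g ≤ a + b * d → Prime (a + b * d) → All (λ p → p ∤ t + d) ps
    prime-sieved {a} {t} b d a≈bt large n-prime = All.map
      (λ {p} (1<p , p<gg , p∣M) p∣t+d →
        <⇒≢ (<-≤-trans p<gg large)
            (prime-divisor-≡ 1<p n-prime (∣-resp-≈ p∣M a+bd≈ (∣n⇒∣m*n b p∣t+d))))
      ps-ok
      where
      a+bd≈ : a + b * d ≈ b * (t + d)
      a+bd≈ = trans (+-congʳ-≈ (b * d) a≈bt) (cong (_% M) (sym (*-distribˡ-+ b t d)))

    -- As `a` never decreases, all later values stay above the threshold and the sieve applies at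
    -- every digit.
    extensions-≤-paths : ∀ m {a b t} → g * g ≤ a → a ≈ b * t → extensions g a b m ≤ paths m t
    extensions-≤-paths zero    large a≈bt = ≤-refl
    extensions-≤-paths (suc m) {a} {b} {t} large a≈bt =
      ≤-trans (extensions-suc g a b m) (sumUpTo-mono g λ {d} _ → pointwise d)
      where
      pointwise : ∀ d → (if isPrime (a + b * d) then extensions g (a + b * d) (b * g) m else 0) ≤
                        (if does (sieved? t d) then paths m (step t d) else 0)
      pointwise d with isPrime (a + b * d) in eq | sieved? t d
      ... | false | _         = z≤n
      ... | true  | yes _     = extensions-≤-paths m (≤-trans large (m≤m+n a (b * d))) (step-≈ b d a≈bt)
      ... | true  | no ¬sieve = contradiction
              (prime-sieved b d a≈bt (≤-trans large (m≤m+n a (b * d))) (isPrime-sound (subst T (sym eq) _))) ¬sieve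

    -- `c-suc` closes the recursion over the next digit: digit 0 contributes at most `c * U m`, the
    -- nonzero digits at most `U m` each.
    module _ (c : ℕ) (c-base : 1 ≤ c * U 0) (c-suc : ∀ m → c * U m + g * U m ≤ c * U (suc m)) where

      -- The sieve does not apply to primes a below g², but these keep their value only along d = 0.
      extensions-≤ : ∀ m {a b t} → g * g ≤ b → a ≈ b * t → extensions g a b m ≤ c * U m
      extensions-≤ zero    large a≈bt = c-base
      extensions-≤ (suc m) {a} {b} {t} large a≈bt =
        ≤-trans (extensions-suc g a b m) (≤-trans (sumUpTo-head g stay leave) (c-suc m))
        where
        next : ℕ → ℕ
        next d = extensions g (a + b * d) (b * g) m
        stay : (if isPrime (a + b * 0) then next 0 else 0) ≤ c * U m
        stay with isPrime (a + b * 0)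
        ... | true  = extensions-≤ m (≤-trans large (m≤m*n b g)) (step-≈ b 0 a≈bt)
        ... | false = z≤n
        -- A nonzero digit lifts the value to at least `b`, hence to `g * g`, and from there on the
        -- path bound holds.
        leave : ∀ d → (if isPrime (a + b * suc d) then next (suc d) else 0) ≤ U m
        leave d with isPrime (a + b * suc d)
        ... | true  = ≤-trans
              (extensions-≤-paths m
                (≤-trans large (≤-trans (m≤m*n b (suc d)) (m≤n+m _ a)))
                (step-≈ b (suc d) a≈bt))
              (paths-≤ m (m%n<n _ M))
        ... | false = z≤n

      -- The first two digits are left free, at a cost of `g * g`, to bring the weight up to the
      -- threshold.
      P-≤ : FirstDigitCondition g → ∀ m → P g (suc (suc m)) ≤ g * (g * (c * U m))
      P-≤ first m = ≤-trans (≤-reflexive (count-allDigits g (suc m) (valid m)))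
        (sumUpTo-bound g λ {d} d<g →
          ≤-trans (≤-reflexive (count-allDigits g m (valid m ∘ (d ∷_))))
                  (sumUpTo-bound g λ {e} _ → two-digits d e d<g))
        where
        valid : ℕ → List ℕ → Bool
        valid m ds = lastNonZero ds ∧ (varpi g ds (suc (suc m)) ≡ᵇ (suc (suc m) ∸ eta g))

        two-digits : ∀ d e → d < g → count (valid m ∘ (d ∷_) ∘ (e ∷_)) (allDigits g m) ≤ c * U m
        two-digits d e d<g = ≤-trans
          -- The state stays unsimplified so as to match two uses of `step-≈` from value 0, weight 1
          -- and residue 0.
          (count-mono {q = allPrime g (0 + 1 * d + 1 * g * e) (1 * g * g)} (All.map implication (allDigits-length g m)))
          (extensions-≤ m (≤-reflexive (cong (_* g) (sym (*-identityˡ g))))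
            (step-≈ (1 * g) e (step-≈ {0} {0} 1 d refl)))
          where
          value-eq : ∀ d e g v → d + g * (e + g * v) ≡ 0 + 1 * d + 1 * g * e + 1 * g * g * v
          value-eq = solve-∀
          implication : ∀ {ds} → length ds ≡ m → T (valid m (d ∷ e ∷ ds)) →
                        T (allPrime g (0 + 1 * d + 1 * g * e) (1 * g * g) ds)
          implication {ds} refl valid-ds = allPrime-complete g _ _ ds λ k k< →
            subst Prime (value-eq d e g (u g ds (suc k)))
              (varpi-primes d<g first (e ∷ ds) (suc (length ds))
                (≡ᵇ⇒≡ _ _ (proj₂ (Equivalence.to T-∧ valid-ds))) (s<s k<))

    -- For geometric `U` the conditions on `c` become numerical. The factor `w` gives room to short
    -- words, whose count may exceed `θ ^ m`.
    module Exponential (θ w c : ℕ) .{{_ : NonZero θ}}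
      (U≡ : ∀ m → U m ≡ w * θ ^ m) (c-base : 1 ≤ c * w) (c-ratio : c + g ≤ c * θ)
      where

      P-exponential : FirstDigitCondition g → P g 1 ≤ g * (g * (c * w)) * θ ^ 1 →
                      ∀ N → 1 ≤ N → P g N ≤ g * (g * (c * w)) * θ ^ N
      P-exponential first P1 (suc zero)    _ = P1
      P-exponential first P1 (suc (suc m)) _ = begin
        P g (suc (suc m))                             ≤⟨ P-≤ c base ratio first m ⟩
        g * (g * (c * U m))                           ≡⟨ cong (λ v → g * (g * (c * v))) (U≡ m) ⟩
        g * (g * (c * (w * θ ^ m)))                   ≡⟨ reassoc g c w (θ ^ m) ⟩
        g * (g * (c * w)) * θ ^ m                     ≤⟨ *-monoʳ-≤ (g * (g * (c * w))) (^-monoʳ-≤ θ (m≤n+m m 2)) ⟩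
        g * (g * (c * w)) * θ ^ suc (suc m)           ∎
        where
        open ≤-Reasoning
        reassoc : ∀ g c w x → g * (g * (c * (w * x))) ≡ g * (g * (c * w)) * x
        reassoc = solve-∀
        base : 1 ≤ c * U 0
        base = subst (λ v → 1 ≤ c * v) (sym (trans (U≡ 0) (*-identityʳ w))) c-base
        expand : ∀ c w θ x → c * θ * (w * x) ≡ c * (w * (θ * x))
        expand = solve-∀
        ratio : ∀ m → c * U m + g * U m ≤ c * U (suc m)
        ratio m = begin
          c * U m + g * U m         ≡⟨ *-distribʳ-+ (U m) c g ⟨
          (c + g) * U m             ≤⟨ *-monoˡ-≤ (U m) c-ratio ⟩
          c * θ * U m               ≡⟨ cong (c * θ *_) (U≡ m) ⟩
          c * θ * (w * θ ^ m)       ≡⟨ expand c w θ (θ ^ m) ⟩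
          c * (w * θ ^ suc m)       ≡⟨ cong (c *_) (U≡ (suc m)) ⟨
          c * U (suc m)             ∎

-- Explicit bounds for the bases 2, 3, 5 and 10.

power-shift : ∀ θ w k m → θ ^ k * (w * θ ^ m) ≤ w * θ ^ (k + m)
power-shift θ w k m = ≤-reflexive (trans (swap (θ ^ k) w (θ ^ m)) (cong (w *_) (sym (^-distribˡ-+-* θ k m))))
  where
  swap : ∀ x w y → x * (w * y) ≡ w * (x * y)
  swap = solve-∀

module Paths (g M h : ℕ) .{{_ : NonZero g}} .{{_ : NonZero M}} (ps : List ℕ) where

  open Sieve g M h ps

  initial? : ∀ (U : ℕ → ℕ) k → Dec (All (λ r → All (λ t → paths r t ≤ U r) (upTo M)) (upTo k))
  initial? U k = all? (λ r → all? (λ t → paths r t ≤? U r) (upTo M)) (upTo k)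

  block? : ∀ k L → Dec (All (λ t → paths k t ≤ L) (upTo M))
  block? k L = all? (λ t → paths k t ≤? L) (upTo M)

  moduli? : Dec (All (λ p → 1 < p × p < g * g × p ∣ M) ps)
  moduli? = all? (λ p → (1 <? p) ×-dec (p <? g * g) ×-dec (p ∣? M)) ps

-- The numbers of sieved binary words of length m are at most Fibonacci numbers, hence at most 5 for m = 3.
U₂ : ℕ → ℕ
U₂ 0                   = 1
U₂ 1                   = 2
U₂ 2                   = 3
U₂ (suc (suc (suc m))) = 5 * U₂ m

-- The growth is weakest from 2 to 3, and `(4 + 2) / 4 = 3 / 2` makes 4 the least possible constant.
U₂-ratio : ∀ m → 4 * U₂ m + 2 * U₂ m ≤ 4 * U₂ (suc m)
U₂-ratio 0                   = from-yes (6 ≤? 8)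
U₂-ratio 1                   = from-yes (12 ≤? 12)
U₂-ratio 2                   = from-yes (18 ≤? 20)
U₂-ratio (suc (suc (suc m))) = subst₂ _≤_ (e₁ (U₂ m)) (e₂ (U₂ (suc m))) (*-monoʳ-≤ 5 (U₂-ratio m))
  where
  e₁ : ∀ x → 5 * (4 * x + 2 * x) ≡ 4 * (5 * x) + 2 * (5 * x)
  e₁ = solve-∀
  e₂ : ∀ y → 5 * (4 * y) ≡ 4 * (5 * y)
  e₂ = solve-∀

-- Three digits multiply both sides by 125, so `U₂ m ^ 3 / 5 ^ m` only takes the values 1, 8/5 and
-- 27/25.
U₂-cube : ∀ m → U₂ m ^ 3 ≤ 2 * 5 ^ m
U₂-cube 0                   = from-yes (1 ≤? 2)
U₂-cube 1                   = from-yes (8 ≤? 10)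
U₂-cube 2                   = from-yes (27 ≤? 50)
U₂-cube (suc (suc (suc m))) = subst₂ _≤_ (e₁ (U₂ m)) (e₂ (5 ^ m)) (*-monoʳ-≤ 125 (U₂-cube m))
  where
  e₁ : ∀ x → 125 * (x * (x * (x * 1))) ≡ 5 * x * (5 * x * (5 * x * 1))
  e₁ = solve-∀
  e₂ : ∀ y → 125 * (2 * y) ≡ 2 * (5 * (5 * (5 * y)))
  e₂ = solve-∀

-- Cubing avoids the irrational rate. Here 8192 is `2 * 16 ^ 3`, with 16 from two free binary digits
-- and `c = 4`.
P₂-bound : ∀ N → 1 ≤ N → P 2 N ^ 3 ≤ 8192 * 5 ^ N
P₂-bound (suc zero)    _ = from-yes (P 2 1 ^ 3 ≤? 8192 * 5 ^ 1)
P₂-bound (suc (suc m)) _ = begin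
  P 2 (suc (suc m)) ^ 3          ≤⟨ ^-monoˡ-≤ 3 (P-≤ 4 (s≤s z≤n) U₂-ratio (inj₂ (refl , no-prime-digit)) m) ⟩
  (2 * (2 * (4 * U₂ m))) ^ 3     ≡⟨ e (U₂ m) ⟩
  4096 * U₂ m ^ 3                ≤⟨ *-monoʳ-≤ 4096 (U₂-cube m) ⟩
  4096 * (2 * 5 ^ m)             ≡⟨ *-assoc 4096 2 (5 ^ m) ⟨
  8192 * 5 ^ m                   ≤⟨ *-monoʳ-≤ 8192 (^-monoʳ-≤ 5 (m≤n+m m 2)) ⟩
  8192 * 5 ^ suc (suc m)         ∎
  where
  open ≤-Reasoning
  open Paths 2 3 2 (3 ∷ [])
  open Sieve.Bound 2 3 2 (3 ∷ []) refl (from-yes moduli?) U₂ 2 5 (λ m → ≤-refl)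
    (from-yes (initial? U₂ 3)) (from-yes (block? 3 5))
  no-prime-digit : ∀ d → d < 2 → ¬ Prime d
  no-prime-digit 0 _ = from-no (prime? 0)
  no-prime-digit 1 _ = from-no (prime? 1)
  no-prime-digit (suc (suc d)) (s≤s (s≤s ()))
  e : ∀ x → 2 * (2 * (4 * x)) * (2 * (2 * (4 * x)) * (2 * (2 * (4 * x)) * 1)) ≡ 4096 * (x * (x * (x * 1)))
  e = solve-∀

-- Parity leaves at most two of the digits 0, 1, 2.
P₃-bound : ∀ N → 1 ≤ N → P 3 N ≤ 27 * 2 ^ N
P₃-bound = P-exponential (inj₁ refl) (from-yes (P 3 1 ≤? 27 * 2 ^ 1))
  where
  open Paths 3 2 1 (2 ∷ [])
  open Sieve.Bound 3 2 1 (2 ∷ []) refl (from-yes moduli?) (λ m → 1 * 2 ^ m) 0 2 (power-shift 2 1 1)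
    (from-yes (initial? (λ m → 1 * 2 ^ m) 1)) (from-yes (block? 1 2))
  open Exponential 2 1 3 (λ m → refl) (s≤s z≤n) (from-yes (6 ≤? 6))

-- Of the five consecutive integers `t + d`, at most two are coprime to 6.
P₅-bound : ∀ N → 1 ≤ N → P 5 N ≤ 125 * 2 ^ N
P₅-bound = P-exponential (inj₁ refl) (from-yes (P 5 1 ≤? 125 * 2 ^ 1))
  where
  open Paths 5 6 5 (2 ∷ 3 ∷ [])
  open Sieve.Bound 5 6 5 (2 ∷ 3 ∷ []) refl (from-yes moduli?) (λ m → 1 * 2 ^ m) 0 2 (power-shift 2 1 1)
    (from-yes (initial? (λ m → 1 * 2 ^ m) 1)) (from-yes (block? 1 2))
  open Exponential 2 1 5 (λ m → refl) (s≤s z≤n) (from-yes (10 ≤? 10))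

-- The sieve by 3 and 7 alone leaves growth rate 6.08… per digit. With 11 as well a single digit can still have
-- 7 continuations, but four consecutive digits have at most 1289 ≤ 6⁴.
P₁₀-bound : ∀ N → 1 ≤ N → P 10 N ≤ 400 * 6 ^ N
P₁₀-bound = P-exponential (inj₁ refl) (from-yes (P 10 1 ≤? 400 * 6 ^ 1))
  where
  open Paths 10 231 208 (3 ∷ 7 ∷ 11 ∷ [])
  open Sieve.Bound 10 231 208 (3 ∷ 7 ∷ 11 ∷ []) refl (from-yes moduli?) (λ m → 2 * 6 ^ m) 3 1296 (power-shift 6 2 4)
    (from-yes (initial? (λ m → 2 * 6 ^ m) 4)) (from-yes (block? 4 1296))
  open Exponential 6 2 2 (λ m → refl) (s≤s z≤n) (from-yes (12 ≤? 12))

theorem3p2 : (Σ ℕ λ C → 0 < C × (∀ N → 1 ≤ N → P 2 N ^ 3 ≤ C * 5 ^ N))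
    × (Σ ℕ λ C → 0 < C × (∀ N → 1 ≤ N → P 3 N ≤ C * 2 ^ N))
    × (Σ ℕ λ C → 0 < C × (∀ N → 1 ≤ N → P 5 N ≤ C * 2 ^ N))
    × (Σ ℕ λ C → 0 < C × (∀ N → 1 ≤ N → P 10 N ≤ C * 6 ^ N))
theorem3p2 = (8192 , z<s , P₂-bound) , (27 , z<s , P₃-bound) , (125 , z<s , P₅-bound) , (400 , z<s , P₁₀-bound)
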